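{- On the class of linear orders, (1) $\mathrm{FO}(<)$-sentences are $2^{O(m)}$-succinct in $\mathrm{FO}^3(<)$-sentences, i.e., there is a constant $c$ such that for every $\mathrm{FO}(<)$-sentence $\varphi$ there is an $\mathrm{FO}^3(<)$-sentence $\psi$ with $|\psi|\le 2^{c\cdot|\varphi|}$ and $\mathcal{A}_N\models\psi\iff\mathcal{A}_N\models\varphi$ for all $N\in\mathbb{N}$; and (2) $\mathrm{FO}^4(<)$-sentences are not $2^{o(m)}$-succinct in $\mathrm{FO}^3(<)$-sentences, i.e., there is no function $f\colon\mathbb{N}\to\mathbb{N}$ with $f(m)=2^{o(m)}$ such that for every $\mathrm{FO}^4(<)$-sentence $\varphi$ there is an $\mathrm{FO}^3(<)$-sentence $\psi$ with $|\psi|\le f(|\varphi|)$ and $\mathcal{A}_N\models\psi\iff\mathcal{A}_N\models\varphi$ for all $N\in\mathbb{N}$.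
   Context: For $N\in\mathbb{N}$, $\mathcal{A}_N$ is the linear order with universe $\{0,\dots,N\}$ and the natural order $<$; the class of linear orders is identified with $\{\mathcal{A}_N : N\in\mathbb{N}\}$. $\mathrm{FO}^k(<)$ denotes the $k$-variable fragment of first-order logic over signature $\{<\}$ (formulas using only $k$ distinct variables, which may be requantified), and $\mathrm{FO}(<)$ is full first-order logic over $\{<\}$. The size $|\varphi|$ of a formula is the number of nodes of its syntax tree (leaves are atomic formulas, inner nodes are Boolean connectives or quantifiers). -}

module Defs where

open import Data.Nat using (ℕ; zero; suc; _+_; _*_; _^_; _≤_; _<_; _≡ᵇ_)
open import Data.Fin as Fin using (Fin)
open import Data.Bool using (if_then_else_)
open import Data.List using (List; []; _∷_)
open import Data.List.Membership.Propositional using (_∈_)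
open import Data.Product using (Σ; _×_; ∃)
open import Data.Sum using (_⊎_)
open import Data.Empty using (⊥)
open import Relation.Binary.PropositionalEquality using (_≡_)
open import Function.Bundles using (_⇔_)

Var : Set
Var = ℕ

data Formula : Set where
  _≺_  : Var → Var → Formula
  _≐_  : Var → Var → Formula
  ¬'_  : Formula → Formula
  _∧'_ : Formula → Formula → Formula
  _∨'_ : Formula → Formula → Formula
  ∃'   : Var → Formula → Formula
  ∀'   : Var → Formula → Formula

size : Formula → ℕ
size (x ≺ y)  = 1
size (x ≐ y)  = 1
size (¬' φ)   = suc (size φ)
size (φ ∧' ψ) = suc (size φ + size ψ)
size (φ ∨' ψ) = suc (size φ + size ψ)
size (∃' x φ) = suc (size φ)
size (∀' x φ) = suc (size φ)

InFO : ℕ → Formula → Set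
InFO k (x ≺ y)  = x < k × y < k
InFO k (x ≐ y)  = x < k × y < k
InFO k (¬' φ)   = InFO k φ
InFO k (φ ∧' ψ) = InFO k φ × InFO k ψ
InFO k (φ ∨' ψ) = InFO k φ × InFO k ψ
InFO k (∃' x φ) = x < k × InFO k φ
InFO k (∀' x φ) = x < k × InFO k φ

Scoped : List Var → Formula → Set
Scoped Γ (x ≺ y)  = x ∈ Γ × y ∈ Γ
Scoped Γ (x ≐ y)  = x ∈ Γ × y ∈ Γ
Scoped Γ (¬' φ)   = Scoped Γ φ
Scoped Γ (φ ∧' ψ) = Scoped Γ φ × Scoped Γ ψ
Scoped Γ (φ ∨' ψ) = Scoped Γ φ × Scoped Γ ψ
Scoped Γ (∃' x φ) = Scoped (x ∷ Γ) φ
Scoped Γ (∀' x φ) = Scoped (x ∷ Γ) φ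

Sentence : Formula → Set
Sentence = Scoped []

-- The linear order A_N has universe {0,…,N} = Fin (suc N) with its natural order.
Assignment : ℕ → Set
Assignment N = Var → Fin (suc N)

_[_↦_] : ∀ {N} → Assignment N → Var → Fin (suc N) → Assignment N
(a [ x ↦ d ]) y = if y ≡ᵇ x then d else a y

Sat : (N : ℕ) → Assignment N → Formula → Set
Sat N a (x ≺ y)  = a x Fin.< a y
Sat N a (x ≐ y)  = a x ≡ a y
Sat N a (¬' φ)   = Sat N a φ → ⊥
Sat N a (φ ∧' ψ) = Sat N a φ × Sat N a ψ
Sat N a (φ ∨' ψ) = Sat N a φ ⊎ Sat N a ψ
Sat N a (∃' x φ) = Σ (Fin (suc N)) (λ d → Sat N (a [ x ↦ d ]) φ)
Sat N a (∀' x φ) = (d : Fin (suc N)) → Sat N (a [ x ↦ d ]) φ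

-- A_N ⊨ φ for a sentence φ (the assignment is irrelevant; we use the constant 0 one).
Models : ℕ → Formula → Set
Models N φ = Sat N (λ _ → Fin.zero) φ

EquivOnOrders : Formula → Formula → Set
EquivOnOrders ψ φ = (N : ℕ) → Models N ψ ⇔ Models N φ

-- f(m) = 2^{o(m)}: for every ε = 1/q > 0, eventually f(m) ≤ 2^{m/q},
-- i.e. f(m)^q ≤ 2^m for all large m.
SubExponential : (ℕ → ℕ) → Set
SubExponential f = (q : ℕ) → 1 ≤ q → ∃ λ m₀ → (m : ℕ) → m₀ ≤ m → f m ^ q ≤ 2 ^ m

{-# OPTIONS --safe #-}
module Submission where

-- To a formula φ we attach thresholds sep φ u v for pairs of anchors (variables and the two
-- ends of the order) such that φ cannot distinguish interpretations whose anchor distances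
-- agree up to these thresholds.  A quantifier over x replaces the threshold at (u , v) by the
-- maximum of itself and the sum of those at (u , x) and (x , v), and resets those at x to 1.
--
-- For arbitrary φ the thresholds are at most 2 ^ size φ, so the truth of a sentence in A_N
-- depends only on N ⊓ 2 ^ size φ, and this finite truth table is a short FO³-sentence.
-- For FO³-formulas of size s, thresholds between variables stay O(s), and therefore those
-- involving the ends are O(s²): an FO³-sentence separating A_N from A_{N+1} has size at least
-- about √N.  But an FO⁴-sentence of size O(m) expresses N ≤ 2 ^ m by repeated halving.

open import Defs
open import Data.Nat using (ℕ; _*_; _^_; _≤_)
open import Data.Product using (Σ; _×_; ∃)
open import Relation.Nullary using (¬_)

open import Data.Nat using (zero; suc; _+_; _∸_; _⊔_; _⊓_; _<_; _≡ᵇ_; z≤n; s≤s; ∣_-_∣)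
open import Data.Nat.Properties
open import Data.Nat.Tactic.RingSolver using (solve-∀)
open import Data.Bool using (Bool; true; false; T; if_then_else_)
open import Data.Fin as Fin using (Fin; toℕ; fromℕ<; fromℕ)
open import Data.Fin.Properties as Fin using (toℕ<n; toℕ-fromℕ<; toℕ-fromℕ; toℕ-injective; all?; any?)
open import Data.List using (List; []; _∷_; map; filter)
open import Data.List.Membership.Propositional using (_∈_)
open import Data.List.Membership.Propositional.Properties using (∈-filter⁺; ∈-filter⁻; ∈-map⁺)
open import Data.List.Relation.Unary.Any using (here; there)
open import Data.Product using (_,_; proj₁; proj₂; ∃₂)
open import Data.Sum using (_⊎_; inj₁; inj₂; map₂)
import Data.Sum as Sum
open import Data.Unit using (tt)
open import Function using (_∘_)
open import Function.Bundles using (_⇔_; mk⇔; Equivalence)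
open import Relation.Binary.PropositionalEquality
open import Relation.Nullary using (Dec; yes; no; ¬?; contradiction)
open import Relation.Nullary.Decidable using (_×-dec_; _⊎-dec_; _→-dec_; map′; ⌊_⌋; toWitness; fromWitness; from-yes)

open ≤-Reasoning

-- Truncated differences and the extension step

-- The difference y − x, truncated to the integers t = j − i with −e < t ≤ e, does not
-- decrease when passing to y′ − x′.
Approx : ℕ → (x y x′ y′ : ℕ) → Set
Approx e x y x′ y′ = ∀ i j → j ≤ e + i → i < e + j → x + j ≤ y + i → x′ + j ≤ y′ + i

Approx-weaken : ∀ {e f x y x′ y′} → e ≤ f → Approx f x y x′ y′ → Approx e x y x′ y′
Approx-weaken e≤f h i j j≤ i< =
  h i j (≤-trans j≤ (+-monoˡ-≤ i e≤f)) (≤-trans i< (+-monoˡ-≤ j e≤f))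

Approx-cong : ∀ {e x y x′ y′ z w z′ w′} → z ≡ x → w ≡ y → z′ ≡ x′ → w′ ≡ y′ →
  Approx e x y x′ y′ → Approx e z w z′ w′
Approx-cong refl refl refl refl h = h

Approx-refl : ∀ {e} x x′ → Approx e x x x′ x′
Approx-refl x x′ i j _ _ h = +-monoʳ-≤ x′ (+-cancelˡ-≤ x j i h)

-- By contraposition: a failure at t for the reversed pair is a success at 1 - t for the original
-- one, and t ↦ 1 - t maps the window -e < t ≤ e onto itself. This is why the window is asymmetric.
Approx-flip : ∀ {e} x y x′ y′ → Approx e x y x′ y′ → Approx e y′ x′ y x
Approx-flip {e} x y x′ y′ h i j j≤ i< le = ≮⇒≥ λ lt →
  <-irrefl refl (begin-strict
    x′ + i     <⟨ +-monoʳ-< x′ (n<1+n i) ⟩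
    x′ + suc i ≤⟨ h j (suc i) i< (subst (j <_) (sym (+-suc e i)) (s≤s j≤))
                    (subst (_≤ y + j) (sym (+-suc x i)) lt) ⟩
    y′ + j     ≤⟨ le ⟩
    x′ + i     ∎)

-- The constraint of Approx e u x u′ y at some (i , j) forces lo ≤ y.
Tight : (e u x u′ lo : ℕ) → Set
Tight e u x u′ lo = ∃₂ λ i j → j ≤ e + i × i < e + j × u + j ≤ x + i × lo + i ≤ u′ + j

gap : ∀ x {d i j} → x + d + j ≤ x + i → d + j ≤ i
gap x {d} {i} {j} le = +-cancelˡ-≤ x (d + j) i (subst (_≤ x + i) (+-assoc x d j) le)

-- Among the t in the window with t ≤ x - u only the largest matters; it forces y ≥ u′ + t. If there
-- is none (`x` lies at least `e` below `u`), or if u′ + t is not positive, the bound is `0`.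
lowerBound : ∀ e u x u′ → 1 ≤ e → ∃ λ lo →
  (∀ y → lo ≤ y → Approx e u x u′ y) × (lo ≡ 0 ⊎ Tight e u x u′ lo)
lowerBound e u x u′ 1≤e with ≤-total u x
... | inj₁ u≤x with m≤n⇒∃[o]m+o≡n u≤x
... | d , refl = u′ + (d ⊓ e) , sound , inj₂
    (0 , d ⊓ e , ≤-trans (m⊓n≤n d e) (m≤m+n e 0) , ≤-trans 1≤e (m≤m+n e _)
    , ≤-trans (+-monoʳ-≤ u (m⊓n≤m d e)) (m≤m+n (u + d) 0) , ≤-reflexive (+-identityʳ _))
  where
  sound : ∀ y → u′ + (d ⊓ e) ≤ y → Approx e u (u + d) u′ y
  sound y lo≤y i j j≤ _ le = begin
    u′ + j           ≤⟨ +-monoʳ-≤ u′ (⊓-glb (+-cancelˡ-≤ u j (d + i) (subst (u + j ≤_) (+-assoc u d i) le)) j≤) ⟩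
    u′ + ((d + i) ⊓ (e + i)) ≡⟨ cong (u′ +_) (sym (+-distribʳ-⊓ i d e)) ⟩
    u′ + (d ⊓ e + i) ≡⟨ sym (+-assoc u′ _ i) ⟩
    u′ + d ⊓ e + i   ≤⟨ +-monoˡ-≤ i lo≤y ⟩
    y + i            ∎
lowerBound e u x u′ 1≤e | inj₂ x≤u with m≤n⇒∃[o]m+o≡n x≤u
... | d , refl with e ≤? d
... | yes e≤d = 0 , (λ y _ i j _ i< le → contradiction
        (≤-trans i< (≤-trans (+-monoˡ-≤ j e≤d) (gap x le))) (<-irrefl refl)) , inj₁ refl
... | no e≰d = u′ ∸ d , sound , tight
  where
  sound : ∀ y → u′ ∸ d ≤ y → Approx e (x + d) x u′ y
  sound y lo≤y i j _ _ le = begin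
    u′ + j           ≤⟨ +-monoˡ-≤ j (m≤n+m∸n u′ d) ⟩
    d + (u′ ∸ d) + j ≤⟨ +-monoˡ-≤ j (+-monoʳ-≤ d lo≤y) ⟩
    d + y + j        ≡⟨ cong (_+ j) (+-comm d y) ⟩
    y + d + j        ≡⟨ +-assoc y d j ⟩
    y + (d + j)      ≤⟨ +-monoʳ-≤ y (gap x le) ⟩
    y + i            ∎
  tight : u′ ∸ d ≡ 0 ⊎ Tight e (x + d) x u′ (u′ ∸ d)
  tight with ≤-total d u′
  ... | inj₁ d≤u′ = inj₂ (d , 0 , z≤n , ≤-trans (≰⇒> e≰d) (m≤m+n e 0)
      , ≤-reflexive (+-identityʳ _) , ≤-reflexive (trans (m∸n+n≡m d≤u′) (sym (+-identityʳ u′))))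
  ... | inj₂ u′≤d = inj₁ (m≤n⇒m∸n≡0 u′≤d)

maxLowerBound : ∀ {A : Set} (us : List A) (e p p′ : A → ℕ) (x : ℕ) → (∀ u → 1 ≤ e u) → ∃ λ lo →
  (∀ y → lo ≤ y → ∀ u → u ∈ us → Approx (e u) (p u) x (p′ u) y) ×
  (lo ≡ 0 ⊎ ∃ λ u → u ∈ us × Tight (e u) (p u) x (p′ u) lo)
maxLowerBound [] e p p′ x pos = 0 , (λ _ _ _ ()) , inj₁ refl
maxLowerBound (w ∷ us) e p p′ x pos
  with lowerBound (e w) (p w) x (p′ w) (pos w) | maxLowerBound us e p p′ x pos
... | l , sound , tight | m , sounds , tights = l ⊔ m , both , attained
  where
  both : ∀ y → l ⊔ m ≤ y → ∀ u → u ∈ w ∷ us → Approx (e u) (p u) x (p′ u) y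
  both y le u (here refl) = sound y (≤-trans (m≤m⊔n l m) le)
  both y le u (there u∈)  = sounds y (≤-trans (m≤n⊔m l m) le) u u∈
  Attained : ℕ → Set
  Attained lo = lo ≡ 0 ⊎ ∃ λ u → u ∈ w ∷ us × Tight (e u) (p u) x (p′ u) lo
  attained : Attained (l ⊔ m)
  attained with ⊔-sel l m
  ... | inj₁ eq = subst Attained (sym eq) (map₂ (λ t → w , here refl , t) tight)
  ... | inj₂ eq = subst Attained (sym eq) (map₂ (λ (u , u∈ , t) → u , there u∈ , t) tights)

-- The extension step of the Ehrenfeucht–Fraïssé game.  The constraints on the answer x′ are
-- intervals, so by the one-dimensional Helly theorem they need only be compatible in pairs:
-- x′ is the largest of the lower bounds.
extend : ∀ {A : Set} (us : List A) (b : A) (D : A → A → ℕ) (e f p p′ : A → ℕ) (x : ℕ) →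
  b ∈ us → p b ≡ 0 → (∀ u → 1 ≤ e u) → (∀ u v → u ∈ us → v ∈ us → e u + f v ≤ D u v) →
  (∀ u v → u ∈ us → v ∈ us → Approx (D u v) (p u) (p v) (p′ u) (p′ v)) →
  ∃ λ x′ → (∀ u → u ∈ us → Approx (e u) (p u) x (p′ u) x′)
         × (∀ v → v ∈ us → Approx (f v) x (p v) x′ (p′ v))
extend us b D e f p p′ x b∈ pb pos e+f≤D sim with maxLowerBound us e p p′ x pos
... | x′ , sound , tight = x′ , sound x′ ≤-refl , λ v v∈ → above v v∈ (attained tight)
  where
  attained : x′ ≡ 0 ⊎ _ → ∃ λ u → u ∈ us × Tight (e u) (p u) x (p′ u) x′
  attained (inj₂ t)    = t
  -- The trivial bound `0` counts as forced by `b`, which sits at position `0`, so every upper bound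
  -- has a tight anchor to be compared with.
  attained (inj₁ refl) = b , b∈ , 0 , 0 , z≤n , ≤-trans (pos b) (m≤m+n _ 0) ,
    subst (λ w → w + 0 ≤ x + 0) (sym pb) z≤n , z≤n
  above : ∀ v → v ∈ us → (∃ λ u → u ∈ us × Tight (e u) (p u) x (p′ u) x′) →
          Approx (f v) x (p v) x′ (p′ v)
  above v v∈ (u , u∈ , i , j , j≤ , i< , lower , attain) k l l≤ k< upper =
    +-cancelʳ-≤ i (x′ + l) (p′ v + k) (begin
      x′ + l + i       ≡⟨ swap x′ l i ⟩
      x′ + i + l       ≤⟨ +-monoˡ-≤ l attain ⟩
      p′ u + j + l     ≡⟨ +-assoc (p′ u) j l ⟩
      -- The shifts from `u` to `x` and from `x` to `v` add up, and their sum lies in the window of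
      -- `D u v` because `e u + f v ≤ D u v`.
      p′ u + (j + l)   ≤⟨ Approx-weaken (e+f≤D u v u∈ v∈) (sim u v u∈ v∈) (i + k) (j + l)
                            (≤-trans (+-mono-≤ j≤ l≤) (≤-reflexive (inter (e u) i (f v) k)))
                            (≤-trans (+-mono-<-≤ i< (<⇒≤ k<)) (≤-reflexive (inter (e u) j (f v) l)))
                            chain ⟩
      p′ v + (i + k)   ≡⟨ rot (p′ v) i k ⟩
      p′ v + k + i     ∎)
    where
    swap : ∀ a b c → a + b + c ≡ a + c + b
    swap = solve-∀
    rot : ∀ a b c → a + (b + c) ≡ a + c + b
    rot = solve-∀
    inter : ∀ a b c d → a + b + (c + d) ≡ a + c + (b + d)
    inter = solve-∀
    chain : p u + (j + l) ≤ p v + (i + k)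
    chain = begin
      p u + (j + l) ≡⟨ sym (+-assoc (p u) j l) ⟩
      p u + j + l   ≤⟨ +-monoˡ-≤ l lower ⟩
      x + i + l     ≡⟨ swap x i l ⟩
      x + l + i     ≤⟨ +-monoˡ-≤ i upper ⟩
      p v + k + i   ≡⟨ sym (rot (p v) i k) ⟩
      p v + (i + k) ∎

-- Anchors and the thresholds of a formula

data Anchor : Set where
  bot top : Anchor
  var     : Var → Anchor

var-injective : ∀ {x y} → var x ≡ var y → x ≡ y
var-injective refl = refl

_≟A_ : (u v : Anchor) → Dec (u ≡ v)
bot   ≟A bot   = yes refl
bot   ≟A top   = no λ ()
bot   ≟A var y = no λ ()
top   ≟A bot   = no λ ()
top   ≟A top   = yes refl
top   ≟A var y = no λ ()
var x ≟A bot   = no λ ()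
var x ≟A top   = no λ ()
var x ≟A var y = map′ (cong var) var-injective (x ≟ y)

position : ∀ N → Assignment N → Anchor → ℕ
position N a bot     = 0
position N a top     = N
position N a (var x) = toℕ (a x)

update-≡ : ∀ {N} (a : Assignment N) x d → (a [ x ↦ d ]) x ≡ d
update-≡ a x d with x ≡ᵇ x in eq
... | true  = refl
... | false = contradiction (subst T eq (≡⇒≡ᵇ x x refl)) λ ()

update-≢ : ∀ {N} (a : Assignment N) {x y} d → y ≢ x → (a [ x ↦ d ]) y ≡ a y
update-≢ a {x} {y} d y≢x with y ≡ᵇ x in eq
... | true  = contradiction (≡ᵇ⇒≡ y x (subst T (sym eq) tt)) y≢x
... | false = refl

position-≢ : ∀ N (a : Assignment N) x d u → u ≢ var x → position N (a [ x ↦ d ]) u ≡ position N a u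
position-≢ N a x d bot     _  = refl
position-≢ N a x d top     _  = refl
position-≢ N a x d (var y) u≢ = cong toℕ (update-≢ a d (u≢ ∘ cong var))

Separator : Set
Separator = Anchor → Anchor → ℕ

-- The outer value of `x` is shadowed under the quantifier, so the thresholds at `x` fall to the
-- least admissible value. This is `1` and not `0`, since `extend` asks for positive thresholds.
eliminate : Var → Separator → Separator
eliminate x E u v with u ≟A var x | v ≟A var x
... | yes _ | _     = 1
... | no _  | yes _ = 1
... | no _  | no _  = E u v ⊔ (E u (var x) + E (var x) v)

eliminate-≢ : ∀ x E u v → u ≢ var x → v ≢ var x →
  eliminate x E u v ≡ E u v ⊔ (E u (var x) + E (var x) v)
eliminate-≢ x E u v u≢ v≢ with u ≟A var x | v ≟A var x
... | yes u≡ | _      = contradiction u≡ u≢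
... | no _   | yes v≡ = contradiction v≡ v≢
... | no _   | no _   = refl

eliminate-≡ˡ : ∀ x E v → eliminate x E (var x) v ≡ 1
eliminate-≡ˡ x E v with var x ≟A var x | v ≟A var x
... | yes _ | _     = refl
... | no _  | yes _ = refl
... | no ≢  | no _  = contradiction refl ≢

eliminate-≡ʳ : ∀ x E u → eliminate x E u (var x) ≡ 1
eliminate-≡ʳ x E u with u ≟A var x | var x ≟A var x
... | yes _ | _     = refl
... | no _  | yes _ = refl
... | no _  | no ≢  = contradiction refl ≢

eliminate-≤ : ∀ x E u v {B} → 1 ≤ B →
  (u ≢ var x → v ≢ var x → E u v ≤ B × E u (var x) + E (var x) v ≤ B) → eliminate x E u v ≤ B
eliminate-≤ x E u v 1≤B h with u ≟A var x | v ≟A var x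
... | yes _ | _     = 1≤B
... | no _  | yes _ = 1≤B
... | no u≢ | no v≢ = ⊔-lub (proj₁ (h u≢ v≢)) (proj₂ (h u≢ v≢))

eliminate-sym : ∀ x E → (∀ u v → E u v ≡ E v u) → ∀ u v → eliminate x E u v ≡ eliminate x E v u
eliminate-sym x E s u v with u ≟A var x | v ≟A var x
... | yes _ | yes _ = refl
... | yes _ | no _  = refl
... | no _  | yes _ = refl
... | no _  | no _  = cong₂ _⊔_ (s u v)
  (trans (+-comm (E u (var x)) _) (cong₂ _+_ (s (var x) v) (s u (var x))))

eliminate-pos : ∀ x E → (∀ u v → 1 ≤ E u v) → ∀ u v → 1 ≤ eliminate x E u v
eliminate-pos x E h u v with u ≟A var x | v ≟A var x
... | yes _ | _     = ≤-refl
... | no _  | yes _ = ≤-refl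
... | no _  | no _  = ≤-trans (h u v) (m≤m⊔n _ _)

-- φ cannot tell apart two interpretations in which the distances between the anchors u and v
-- agree or both reach the threshold sep φ u v.
sep : Formula → Separator
sep (x ≺ y)  u v = 1
sep (x ≐ y)  u v = 1
sep (¬' φ)   u v = sep φ u v
sep (φ ∧' ψ) u v = sep φ u v + sep ψ u v
sep (φ ∨' ψ) u v = sep φ u v + sep ψ u v
sep (∃' x φ)     = eliminate x (sep φ)
sep (∀' x φ)     = eliminate x (sep φ)

sep-sym : ∀ φ u v → sep φ u v ≡ sep φ v u
sep-sym (x ≺ y)  u v = refl
sep-sym (x ≐ y)  u v = refl
sep-sym (¬' φ)   u v = sep-sym φ u v
sep-sym (φ ∧' ψ) u v = cong₂ _+_ (sep-sym φ u v) (sep-sym ψ u v)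
sep-sym (φ ∨' ψ) u v = cong₂ _+_ (sep-sym φ u v) (sep-sym ψ u v)
sep-sym (∃' x φ)     = eliminate-sym x (sep φ) (sep-sym φ)
sep-sym (∀' x φ)     = eliminate-sym x (sep φ) (sep-sym φ)

sep-pos : ∀ φ u v → 1 ≤ sep φ u v
sep-pos (x ≺ y)  u v = ≤-refl
sep-pos (x ≐ y)  u v = ≤-refl
sep-pos (¬' φ)   u v = sep-pos φ u v
sep-pos (φ ∧' ψ) u v = ≤-trans (sep-pos φ u v) (m≤m+n _ _)
sep-pos (φ ∨' ψ) u v = ≤-trans (sep-pos φ u v) (m≤m+n _ _)
sep-pos (∃' x φ)     = eliminate-pos x (sep φ) (sep-pos φ)
sep-pos (∀' x φ)     = eliminate-pos x (sep φ) (sep-pos φ)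

-- Similar interpretations and the transfer of truth

anchors : List Var → List Anchor
anchors Γ = bot ∷ top ∷ map var Γ

anchors-tail : ∀ {Γ x u} → u ∈ anchors (x ∷ Γ) → u ≢ var x → u ∈ anchors Γ
anchors-tail (here refl)                  _  = here refl
anchors-tail (there (here refl))          _  = there (here refl)
anchors-tail (there (there (here refl)))  u≢ = contradiction refl u≢
anchors-tail (there (there (there u∈)))   _  = there (there u∈)

record Similar (Γ : List Var) (E : Separator) (N : ℕ) (a : Assignment N) (M : ℕ) (b : Assignment M) : Set where
  constructor similar
  field
    approx : ∀ u v → u ∈ anchors Γ → v ∈ anchors Γ →
      Approx (E u v) (position N a u) (position N a v) (position M b u) (position M b v)

open Similar

Similar-weaken : ∀ {Γ E F N a M b} → (∀ u v → E u v ≤ F u v) → Similar Γ F N a M b → Similar Γ E N a M b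
Similar-weaken E≤F h = similar λ u v u∈ v∈ → Approx-weaken (E≤F u v) (approx h u v u∈ v∈)

Similar-sym : ∀ {Γ E N a M b} → (∀ u v → E u v ≡ E v u) → Similar Γ E N a M b → Similar Γ E M b N a
Similar-sym {N = N} {a} {M} {b} E-sym h = similar λ u v u∈ v∈ →
  Approx-flip (position N a v) (position N a u) (position M b v) (position M b u)
    (Approx-weaken (≤-reflexive (E-sym u v)) (approx h v u v∈ u∈))

-- When `x` is requantified, its old position must not constrain the new one.
anchorsExcept : Var → List Var → List Anchor
anchorsExcept x Γ = filter (λ u → ¬? (u ≟A var x)) (anchors Γ)

∈-except⁺ : ∀ x Γ {u} → u ∈ anchors Γ → u ≢ var x → u ∈ anchorsExcept x Γ
∈-except⁺ x Γ = ∈-filter⁺ (λ u → ¬? (u ≟A var x)) {xs = anchors Γ}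

∈-except⁻ : ∀ x Γ {u} → u ∈ anchorsExcept x Γ → u ∈ anchors Γ × u ≢ var x
∈-except⁻ x Γ = ∈-filter⁻ (λ u → ¬? (u ≟A var x)) {xs = anchors Γ}

Similar-update : ∀ {Γ E N a M b} x (d : Fin (suc N)) (d′ : Fin (suc M)) →
  (∀ u → u ∈ anchors Γ → u ≢ var x → Approx (E u (var x)) (position N a u) (toℕ d) (position M b u) (toℕ d′)) →
  (∀ v → v ∈ anchors Γ → v ≢ var x → Approx (E (var x) v) (toℕ d) (position N a v) (toℕ d′) (position M b v)) →
  (∀ u v → u ∈ anchors Γ → v ∈ anchors Γ → u ≢ var x → v ≢ var x →
    Approx (E u v) (position N a u) (position N a v) (position M b u) (position M b v)) →
  Similar (x ∷ Γ) E N (a [ x ↦ d ]) M (b [ x ↦ d′ ])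
Similar-update {Γ} {E} {N} {a} {M} {b} x d d′ below above rest = similar λ u v u∈ v∈ →
  cases (u ≟A var x) (v ≟A var x) u∈ v∈
  where
  at : ∀ {K} (c : Assignment K) e → toℕ ((c [ x ↦ e ]) x) ≡ toℕ e
  at c e = cong toℕ (update-≡ c x e)

  cases : ∀ {u v} → Dec (u ≡ var x) → Dec (v ≡ var x) → u ∈ anchors (x ∷ Γ) → v ∈ anchors (x ∷ Γ) →
    Approx (E u v) (position N (a [ x ↦ d ]) u) (position N (a [ x ↦ d ]) v)
                   (position M (b [ x ↦ d′ ]) u) (position M (b [ x ↦ d′ ]) v)
  cases (yes refl) (yes refl) _ _ =
    Approx-refl (toℕ ((a [ x ↦ d ]) x)) (toℕ ((b [ x ↦ d′ ]) x))
  cases {v = v} (yes refl) (no v≢) _ v∈ =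
    Approx-cong (at a d) (position-≢ N a x d v v≢) (at b d′) (position-≢ M b x d′ v v≢)
      (above v (anchors-tail v∈ v≢) v≢)
  cases {u} (no u≢) (yes refl) u∈ _ =
    Approx-cong (position-≢ N a x d u u≢) (at a d) (position-≢ M b x d′ u u≢) (at b d′)
      (below u (anchors-tail u∈ u≢) u≢)
  cases {u} {v} (no u≢) (no v≢) u∈ v∈ =
    Approx-cong (position-≢ N a x d u u≢) (position-≢ N a x d v v≢)
        (position-≢ M b x d′ u u≢) (position-≢ M b x d′ v v≢)
      (rest u v (anchors-tail u∈ u≢) (anchors-tail v∈ v≢) u≢ v≢)

Similar-extend : ∀ {Γ E N a M b} x → (∀ u v → 1 ≤ E u v) →
  Similar Γ (eliminate x E) N a M b → (d : Fin (suc N)) →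
  ∃ λ (d′ : Fin (suc M)) → Similar (x ∷ Γ) E N (a [ x ↦ d ]) M (b [ x ↦ d′ ])
Similar-extend {Γ} {E} {N} {a} {M} {b} x E-pos sim d = answer
  (extend (anchorsExcept x Γ) bot (eliminate x E) (λ u → E u (var x)) (E (var x))
    (position N a) (position M b) (toℕ d) (∈-except⁺ x Γ (here refl) λ ()) refl
    (λ u → E-pos u (var x))
    (λ u v u∈ v∈ → ≤-trans (m≤n⊔m (E u v) _) (≤-reflexive (sym (eliminate-≢ x E u v
      (proj₂ (∈-except⁻ x Γ u∈)) (proj₂ (∈-except⁻ x Γ v∈))))))
    (λ u v u∈ v∈ → approx sim u v (proj₁ (∈-except⁻ x Γ u∈)) (proj₁ (∈-except⁻ x Γ v∈))))
  where
  answer : (∃ λ x′ → (∀ u → u ∈ anchorsExcept x Γ → Approx (E u (var x)) (position N a u) (toℕ d) (position M b u) x′)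
                   × (∀ v → v ∈ anchorsExcept x Γ → Approx (E (var x) v) (toℕ d) (position N a v) x′ (position M b v))) →
           ∃ λ (d′ : Fin (suc M)) → Similar (x ∷ Γ) E N (a [ x ↦ d ]) M (b [ x ↦ d′ ])
  answer (x′ , below , above) = d′ , Similar-update x d d′
      (λ u u∈ u≢ → Approx-cong refl refl refl d′≡x′ (below u (∈-except⁺ x Γ u∈ u≢)))
      (λ v v∈ v≢ → Approx-cong refl refl d′≡x′ refl (above v (∈-except⁺ x Γ v∈ v≢)))
      (λ u v u∈ v∈ u≢ v≢ → Approx-weaken
        (≤-trans (m≤m⊔n (E u v) _) (≤-reflexive (sym (eliminate-≢ x E u v u≢ v≢)))) (approx sim u v u∈ v∈))
    where
    -- The constraint towards `top` at shift 0 turns d ≤ N into x′ ≤ M, so the answer is an element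
    -- of the second order.
    x′≤M : x′ ≤ M
    x′≤M = subst₂ _≤_ (+-identityʳ x′) (+-identityʳ M)
      (above top (∈-except⁺ x Γ (there (here refl)) λ ()) 0 0 z≤n
        (≤-trans (E-pos (var x) top) (m≤m+n _ 0)) (+-monoˡ-≤ 0 (≤-pred (toℕ<n d))))

    d′ : Fin (suc M)
    d′ = fromℕ< (s≤s x′≤M)

    d′≡x′ : toℕ d′ ≡ x′
    d′≡x′ = toℕ-fromℕ< (s≤s x′≤M)

var∈ : ∀ {x Γ} → x ∈ Γ → var x ∈ anchors Γ
var∈ x∈ = there (there (∈-map⁺ var x∈))

transfer : ∀ φ {Γ N a M b} → Scoped Γ φ → Similar Γ (sep φ) N a M b → Sat N a φ → Sat M b φ
-- At threshold `1` the window is {0, 1}: shift 1 transfers strict order, and shift 0, taken in both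
-- directions, transfers equality.
transfer (x ≺ y) {N = N} {a} {M} {b} (x∈ , y∈) sim lt =
  subst₂ _≤_ (+-comm (toℕ (b x)) 1) (+-identityʳ (toℕ (b y)))
    (approx sim (var x) (var y) (var∈ x∈) (var∈ y∈) 0 1 ≤-refl (s≤s z≤n)
      (subst₂ _≤_ (+-comm 1 (toℕ (a x))) (sym (+-identityʳ (toℕ (a y)))) lt))
transfer (x ≐ y) {N = N} {a} {M} {b} (x∈ , y∈) sim eq =
  toℕ-injective (≤-antisym (le x∈ y∈ (≤-reflexive (cong toℕ eq))) (le y∈ x∈ (≤-reflexive (cong toℕ (sym eq)))))
  where
  le : ∀ {x y} → x ∈ _ → y ∈ _ → toℕ (a x) ≤ toℕ (a y) → toℕ (b x) ≤ toℕ (b y)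
  le {x} {y} x∈ y∈ h = +-cancelʳ-≤ 0 (toℕ (b x)) (toℕ (b y))
    (approx sim (var x) (var y) (var∈ x∈) (var∈ y∈) 0 0 z≤n (s≤s z≤n) (+-monoˡ-≤ 0 h))
transfer (¬' φ) sc sim ¬s s = ¬s (transfer φ sc (Similar-sym (sep-sym φ) sim) s)
transfer (φ ∧' ψ) (sc , sc′) sim (s , s′) =
  transfer φ sc (Similar-weaken (λ u v → m≤m+n _ _) sim) s ,
  transfer ψ sc′ (Similar-weaken (λ u v → m≤n+m _ (sep φ u v)) sim) s′
transfer (φ ∨' ψ) (sc , sc′) sim (inj₁ s) =
  inj₁ (transfer φ sc (Similar-weaken (λ u v → m≤m+n _ _) sim) s)
transfer (φ ∨' ψ) (sc , sc′) sim (inj₂ s) =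
  inj₂ (transfer ψ sc′ (Similar-weaken (λ u v → m≤n+m _ (sep φ u v)) sim) s)
transfer (∃' x φ) sc sim (d , s) =
  let d′ , sim′ = Similar-extend x (sep-pos φ) sim d in d′ , transfer φ sc sim′ s
-- The challenge `d` lies in the second order, so the similarity is reversed to find the answer and
-- reversed back for the body.
transfer (∀' x φ) sc sim h d =
  let d′ , sim′ = Similar-extend x (sep-pos φ) (Similar-sym (sep-sym (∀' x φ)) sim) d
  in transfer φ sc (Similar-sym (sep-sym φ) sim′) (h d′)

-- A sentence has only the two ends as anchors. From `bot` to `top` every shift in the window is
-- met, as `M` reaches the threshold; from `top` to `bot` none is, as -N lies below the window.
Models-transfer : ∀ φ {N M} → Sentence φ → sep φ bot top ≤ N → sep φ bot top ≤ M →
  Models N φ → Models M φ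
Models-transfer φ {N} {M} sc ≤N ≤M = transfer φ sc (similar sim)
  where
  a : ∀ K → Assignment K
  a K _ = Fin.zero
  sim : ∀ u v → u ∈ anchors [] → v ∈ anchors [] →
    Approx (sep φ u v) (position N (a N) u) (position N (a N) v) (position M (a M) u) (position M (a M) v)
  sim _ _ (here refl)         (here refl)         = Approx-refl 0 0
  sim _ _ (here refl)         (there (here refl)) i j j≤ _ _ = ≤-trans j≤ (+-monoˡ-≤ i ≤M)
  sim _ _ (there (here refl)) (here refl)         i j _ i< le = contradiction
    (≤-trans i< (≤-trans (+-monoˡ-≤ j (≤-trans (≤-reflexive (sep-sym φ top bot)) ≤N)) le)) (<-irrefl refl)
  sim _ _ (there (here refl)) (there (here refl)) = Approx-refl N M

1≤size : ∀ φ → 1 ≤ size φ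
1≤size (x ≺ y)  = ≤-refl
1≤size (x ≐ y)  = ≤-refl
1≤size (¬' φ)   = s≤s z≤n
1≤size (φ ∧' ψ) = s≤s z≤n
1≤size (φ ∨' ψ) = s≤s z≤n
1≤size (∃' x φ) = s≤s z≤n
1≤size (∀' x φ) = s≤s z≤n

-- Translating FO into FO³

2^-+ : ∀ m n {a b} → a ≤ 2 ^ m → b ≤ 2 ^ n → a + b ≤ 2 ^ suc (m + n)
2^-+ m n {a} {b} a≤ b≤ = begin
  a + b                     ≤⟨ +-mono-≤ a≤ b≤ ⟩
  2 ^ m + 2 ^ n             ≤⟨ +-mono-≤ (^-monoʳ-≤ 2 (m≤m+n m n)) (^-monoʳ-≤ 2 (m≤n+m n m)) ⟩
  2 ^ (m + n) + 2 ^ (m + n) ≡⟨ cong (2 ^ (m + n) +_) (sym (+-identityʳ _)) ⟩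
  2 ^ suc (m + n)           ∎

eliminate-2^ : ∀ x E n → (∀ u v → E u v ≤ 2 ^ n) → ∀ u v → eliminate x E u v ≤ 2 ^ suc n
eliminate-2^ x E n h u v = eliminate-≤ x E u v (m^n>0 2 (suc n)) λ _ _ →
  ≤-trans (h u v) (m≤m+n _ _) ,
  ≤-trans (+-mono-≤ (h u (var x)) (h (var x) v)) (≤-reflexive (cong (2 ^ n +_) (sym (+-identityʳ _))))

-- A quantifier at most doubles a uniform bound, and for a binary connective 2^m + 2^n ≤ 2^(m+n+1):
-- one factor `2` per node suffices.
sep≤2^size : ∀ φ u v → sep φ u v ≤ 2 ^ size φ
sep≤2^size (x ≺ y)  u v = s≤s z≤n
sep≤2^size (x ≐ y)  u v = s≤s z≤n
sep≤2^size (¬' φ)   u v = ≤-trans (sep≤2^size φ u v) (m≤m+n _ _)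
sep≤2^size (φ ∧' ψ) u v = 2^-+ (size φ) (size ψ) (sep≤2^size φ u v) (sep≤2^size ψ u v)
sep≤2^size (φ ∨' ψ) u v = 2^-+ (size φ) (size ψ) (sep≤2^size φ u v) (sep≤2^size ψ u v)
sep≤2^size (∃' x φ)     = eliminate-2^ x (sep φ) (size φ) (sep≤2^size φ)
sep≤2^size (∀' x φ)     = eliminate-2^ x (sep φ) (size φ) (sep≤2^size φ)

sat? : ∀ N a φ → Dec (Sat N a φ)
sat? N a (x ≺ y)  = a x Fin.<? a y
sat? N a (x ≐ y)  = a x Fin.≟ a y
sat? N a (¬' φ)   = ¬? (sat? N a φ)
sat? N a (φ ∧' ψ) = sat? N a φ ×-dec sat? N a ψ
sat? N a (φ ∨' ψ) = sat? N a φ ⊎-dec sat? N a ψ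
sat? N a (∃' x φ) = any? λ d → sat? N (a [ x ↦ d ]) φ
sat? N a (∀' x φ) = all? λ d → sat? N (a [ x ↦ d ]) φ

-- Each step goes up to x₁ and copies the value back to x₀, so the same two variables serve at every
-- depth. The atom `0 ≐ 0` stands for truth.
chain : ℕ → Formula
chain zero    = 0 ≐ 0
chain (suc n) = ∃' 1 ((0 ≺ 1) ∧' ∃' 0 ((0 ≐ 1) ∧' chain n))

chain⇒≤ : ∀ n {N} a → Sat N a (chain n) → toℕ (a 0) + n ≤ N
chain⇒≤ zero {N} a _ = subst (_≤ N) (sym (+-identityʳ _)) (≤-pred (toℕ<n (a 0)))
chain⇒≤ (suc n) {N} a (d , lt , _ , refl , s) = begin
  toℕ (a 0) + suc n ≡⟨ +-suc _ n ⟩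
  suc (toℕ (a 0)) + n ≤⟨ +-monoˡ-≤ n lt ⟩
  toℕ d + n ≤⟨ chain⇒≤ n _ s ⟩
  N ∎

≤⇒chain : ∀ n {N} a → toℕ (a 0) + n ≤ N → Sat N a (chain n)
≤⇒chain zero a _ = refl
≤⇒chain (suc n) {N} a le = d , ≤-reflexive (sym d≡) , d , refl ,
  ≤⇒chain n _ (subst (λ k → k + n ≤ N) (sym d≡) le′)
  where
  le′ : suc (toℕ (a 0)) + n ≤ N
  le′ = subst (_≤ N) (+-suc (toℕ (a 0)) n) le
  d<N : suc (toℕ (a 0)) < suc N
  d<N = s≤s (≤-trans (m≤m+n _ n) le′)
  d : Fin (suc N)
  d = fromℕ< d<N
  d≡ : toℕ d ≡ suc (toℕ (a 0))
  d≡ = toℕ-fromℕ< d<N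

chain-size : ∀ n → size (chain n) ≡ suc (6 * n)
chain-size zero    = refl
chain-size (suc n) rewrite chain-size n = eq n
  where
  eq : ∀ n → 6 + suc (6 * n) ≡ suc (6 * suc n)
  eq = solve-∀

chain-scoped : ∀ n {Γ} → 0 ∈ Γ → Scoped Γ (chain n)
chain-scoped zero    0∈ = 0∈ , 0∈
chain-scoped (suc n) 0∈ = (there 0∈ , here refl) , (here refl , there (here refl)) , chain-scoped n (here refl)

chain-FO³ : ∀ n → InFO 3 (chain n)
chain-FO³ zero    = s≤s z≤n , s≤s z≤n
chain-FO³ (suc n) = s≤s (s≤s z≤n) , (s≤s z≤n , s≤s (s≤s z≤n)) , s≤s z≤n , (s≤s z≤n , s≤s (s≤s z≤n)) , chain-FO³ n

atLeast : ℕ → Formula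
atLeast n = ∃' 0 (chain n)

atLeast⇒≤ : ∀ n {N} → Models N (atLeast n) → n ≤ N
atLeast⇒≤ n (d , s) = ≤-trans (m≤n+m n (toℕ d)) (chain⇒≤ n _ s)

≤⇒atLeast : ∀ n {N} → n ≤ N → Models N (atLeast n)
≤⇒atLeast n le = Fin.zero , ≤⇒chain n _ le

-- The entry for `suc n` overrides the earlier ones exactly on the orders with N ≥ n + 1: the
-- disjunction makes them true, the conjunction false, and both leave shorter orders alone. Hence
-- the last entry also decides all longer orders.
table : (ℕ → Bool) → ℕ → Formula
table t zero    = if t 0 then atLeast 0 else ¬' atLeast 0
table t (suc n) = if t (suc n) then table t n ∨' atLeast (suc n) else table t n ∧' (¬' atLeast (suc n))

table-scoped : ∀ t n → Sentence (table t n)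
table-scoped t zero with t 0
... | true  = here refl , here refl
... | false = here refl , here refl
table-scoped t (suc n) with t (suc n)
... | true  = table-scoped t n , chain-scoped (suc n) (here refl)
... | false = table-scoped t n , chain-scoped (suc n) (here refl)

table-FO³ : ∀ t n → InFO 3 (table t n)
table-FO³ t zero with t 0
... | true  = s≤s z≤n , s≤s z≤n , s≤s z≤n
... | false = s≤s z≤n , s≤s z≤n , s≤s z≤n
table-FO³ t (suc n) with t (suc n)
... | true  = table-FO³ t n , s≤s z≤n , chain-FO³ (suc n)
... | false = table-FO³ t n , s≤s z≤n , chain-FO³ (suc n)

table-step : ∀ n k → k ≤ 10 * (suc n * suc n) → suc (k + suc (suc (size (chain (suc n))))) ≤ 10 * (suc (suc n) * suc (suc n))
table-step n k le = begin
  suc (k + suc (suc (size (chain (suc n))))) ≡⟨ cong (λ z → suc (k + suc (suc z))) (chain-size (suc n)) ⟩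
  suc (k + (3 + 6 * suc n))                  ≤⟨ s≤s (+-monoˡ-≤ _ le) ⟩
  -- `14 * n + 20` is the exact difference to the target.
  suc (10 * (suc n * suc n) + (3 + 6 * suc n)) ≤⟨ m≤m+n _ (14 * n + 20) ⟩
  suc (10 * (suc n * suc n) + (3 + 6 * suc n)) + (14 * n + 20) ≡⟨ eq n ⟩
  10 * (suc (suc n) * suc (suc n)) ∎
  where
  eq : ∀ n → suc (10 * (suc n * suc n) + (3 + 6 * suc n)) + (14 * n + 20) ≡ 10 * (suc (suc n) * suc (suc n))
  eq = solve-∀

table-size : ∀ t n → size (table t n) ≤ 10 * (suc n * suc n)
table-size t zero with t 0
... | true  = m≤m+n 2 8
... | false = m≤m+n 3 7
table-size t (suc n) with t (suc n)
... | true  = ≤-trans (s≤s (+-monoʳ-≤ (size (table t n)) (n≤1+n _))) (table-step n _ (table-size t n))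
... | false = table-step n _ (table-size t n)

table-correct : ∀ t n N → Models N (table t n) ⇔ T (t (N ⊓ n))
table-correct t zero N rewrite ⊓-zeroʳ N with t 0
... | true  = mk⇔ (λ _ → tt) (λ _ → ≤⇒atLeast 0 z≤n)
... | false = mk⇔ (λ h → h (≤⇒atLeast 0 z≤n)) (λ ())
table-correct t (suc n) N with N ≤? n
... | yes N≤n rewrite m≤n⇒m⊓n≡m (m≤n⇒m≤1+n N≤n) =
  subst (λ k → Models N (table t (suc n)) ⇔ T (t k)) (m≤n⇒m⊓n≡m N≤n) smaller
  where
  open Equivalence (table-correct t n N)
  smaller : Models N (table t (suc n)) ⇔ T (t (N ⊓ n))
  smaller with t (suc n)
  ... | true  = mk⇔ (λ { (inj₁ s) → to s ; (inj₂ s) → contradiction (≤-trans (atLeast⇒≤ (suc n) s) N≤n) (<-irrefl refl) })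
                    (inj₁ ∘ from)
  ... | false = mk⇔ (to ∘ proj₁) (λ h → from h , λ s → contradiction (≤-trans (atLeast⇒≤ (suc n) s) N≤n) (<-irrefl refl))
... | no N≰n rewrite m≥n⇒m⊓n≡n (≰⇒> N≰n) with t (suc n)
...   | true  = mk⇔ (λ _ → tt) (λ _ → inj₂ (≤⇒atLeast (suc n) (≰⇒> N≰n)))
...   | false = mk⇔ (λ (_ , ¬s) → ¬s (≤⇒atLeast (suc n) (≰⇒> N≰n))) (λ ())

-- The exponent `8` is 6 + 2: the factor 40 is below 2^6, hence at most 2^(6s) for s ≥ 1, and the
-- square of 2^s gives 2^(2s).
size-bound : ∀ s → 1 ≤ s → 10 * (suc (2 ^ s) * suc (2 ^ s)) ≤ 2 ^ (8 * s)
size-bound s 1≤s = begin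
  10 * (suc (2 ^ s) * suc (2 ^ s)) ≤⟨ *-monoʳ-≤ 10 (*-mono-≤ 1+p≤2p 1+p≤2p) ⟩
  10 * ((2 ^ s + 2 ^ s) * (2 ^ s + 2 ^ s)) ≡⟨ eq (2 ^ s) ⟩
  40 * (2 ^ s * 2 ^ s)             ≤⟨ *-monoˡ-≤ (2 ^ s * 2 ^ s) (m≤m+n 40 24) ⟩
  2 ^ 6 * (2 ^ s * 2 ^ s)          ≤⟨ *-monoˡ-≤ (2 ^ s * 2 ^ s) (^-monoʳ-≤ 2 (*-monoʳ-≤ 6 1≤s)) ⟩
  2 ^ (6 * s) * (2 ^ s * 2 ^ s)    ≡⟨ cong (2 ^ (6 * s) *_) (sym (^-distribˡ-+-* 2 s s)) ⟩
  2 ^ (6 * s) * 2 ^ (s + s)        ≡⟨ sym (^-distribˡ-+-* 2 (6 * s) (s + s)) ⟩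
  2 ^ (6 * s + (s + s))            ≡⟨ cong (2 ^_) (eq′ s) ⟩
  2 ^ (8 * s) ∎
  where
  1+p≤2p : suc (2 ^ s) ≤ 2 ^ s + 2 ^ s
  1+p≤2p = +-monoˡ-≤ (2 ^ s) (m^n>0 2 s)
  eq : ∀ p → 10 * ((p + p) * (p + p)) ≡ 40 * (p * p)
  eq = solve-∀
  eq′ : ∀ s → 6 * s + (s + s) ≡ 8 * s
  eq′ = solve-∀

FO³-upperBound : (φ : Formula) → Sentence φ →
  Σ Formula λ ψ → InFO 3 ψ × Sentence ψ × size ψ ≤ 2 ^ (8 * size φ) × EquivOnOrders ψ φ
FO³-upperBound φ sc = table t B , table-FO³ t B , table-scoped t B ,
  ≤-trans (table-size t B) (size-bound (size φ) (1≤size φ)) ,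
  λ N → let open Equivalence (table-correct t B N) in
    mk⇔ (λ s → fromB N (toWitness (to s))) (λ s → from (fromWitness (toB N s)))
  where
  B : ℕ
  B = 2 ^ size φ
  models? : ∀ N → Dec (Models N φ)
  models? N = sat? N _ φ
  t : ℕ → Bool
  t N = ⌊ models? N ⌋
  sep≤B : sep φ bot top ≤ B
  sep≤B = sep≤2^size φ bot top
  -- Orders with `N` beyond `B` agree with the one at `B`, since `B` bounds the threshold between
  -- the two ends.
  fromB : ∀ N → Models (N ⊓ B) φ → Models N φ
  fromB N s with ≤-total N B
  ... | inj₁ N≤B = subst (λ k → Models k φ) (m≤n⇒m⊓n≡m N≤B) s
  ... | inj₂ B≤N = Models-transfer φ sc sep≤B (≤-trans sep≤B B≤N) (subst (λ k → Models k φ) (m≥n⇒m⊓n≡n B≤N) s)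
  toB : ∀ N → Models N φ → Models (N ⊓ B) φ
  toB N s with ≤-total N B
  ... | inj₁ N≤B = subst (λ k → Models k φ) (sym (m≤n⇒m⊓n≡m N≤B)) s
  ... | inj₂ B≤N = subst (λ k → Models k φ) (sym (m≥n⇒m⊓n≡n B≤N)) (Models-transfer φ sc (≤-trans sep≤B B≤N) sep≤B s)

-- Thresholds of FO³-formulas

-- Moved to `Fin 3`, the claim is a finite one and is decided by evaluation. It is where having only
-- three variables enters.
pigeonhole₃ : ∀ {x u v w} → x < 3 → u < 3 → v < 3 → w < 3 → u ≢ v → v ≢ w → u ≢ w →
  x ≡ u ⊎ x ≡ v ⊎ x ≡ w
pigeonhole₃ x< u< v< w< u≢v v≢w u≢w =
  Sum.map (Fin.fromℕ<-injective _ _ x< u<) (Sum.map (Fin.fromℕ<-injective _ _ x< v<) (Fin.fromℕ<-injective _ _ x< w<))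
    (exhaustive (fromℕ< x<) (fromℕ< u<) (fromℕ< v<) (fromℕ< w<)
      (u≢v ∘ Fin.fromℕ<-injective _ _ u< v<) (v≢w ∘ Fin.fromℕ<-injective _ _ v< w<)
      (u≢w ∘ Fin.fromℕ<-injective _ _ u< w<))
  where
  exhaustive : (x u v w : Fin 3) → u ≢ v → v ≢ w → u ≢ w → x ≡ u ⊎ x ≡ v ⊎ x ≡ w
  exhaustive = from-yes (all? λ (x : Fin 3) → all? λ u → all? λ v → all? λ w →
    ¬? (u Fin.≟ v) →-dec (¬? (v Fin.≟ w) →-dec (¬? (u Fin.≟ w) →-dec
      (x Fin.≟ u ⊎-dec (x Fin.≟ v ⊎-dec x Fin.≟ w)))))

-- Bounds of the thresholds of an FO³-formula of size s.  Once x is eliminated the edges at x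
-- drop to 1, so a path through the three variables grows only by a constant per quantifier;
-- the distances to the borders then grow by at most 2s, hence quadratically in total.
record Weight (s : ℕ) (E : Separator) : Set where
  field
    edge  : ∀ {u v} → u < 3 → v < 3 → u ≢ v → E (var u) (var v) ≤ 2 * s
    path  : ∀ {u v w} → u < 3 → v < 3 → w < 3 → u ≢ v → v ≢ w → u ≢ w →
            E (var u) (var v) + E (var v) (var w) ≤ 2 * s
    left  : ∀ {v} → v < 3 → E bot (var v) ≤ s * s
    right : ∀ {v} → v < 3 → E (var v) top ≤ s * s
    span  : E bot top ≤ 2 * (s * s)

open Weight

Weight-atom : Weight 1 (λ _ _ → 1)
Weight-atom .edge _ _ _ = s≤s z≤n
Weight-atom .path _ _ _ _ _ _ = ≤-refl
Weight-atom .left _  = ≤-refl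
Weight-atom .right _ = ≤-refl
Weight-atom .span    = s≤s z≤n

Weight-mono : ∀ {s t E} → s ≤ t → Weight s E → Weight t E
Weight-mono le W .edge u< v< u≢v = ≤-trans (edge W u< v< u≢v) (*-monoʳ-≤ 2 le)
Weight-mono le W .path u< v< w< p q r = ≤-trans (path W u< v< w< p q r) (*-monoʳ-≤ 2 le)
Weight-mono le W .left v<  = ≤-trans (left W v<) (*-mono-≤ le le)
Weight-mono le W .right v< = ≤-trans (right W v<) (*-mono-≤ le le)
Weight-mono le W .span     = ≤-trans (span W) (*-monoʳ-≤ 2 (*-mono-≤ le le))

-- The linear bounds add up, and the quadratic ones do because s² + t² ≤ (s + t)².
Weight-+ : ∀ {s t E F} → Weight s E → Weight t F → Weight (s + t) (λ u v → E u v + F u v)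
Weight-+ {s} {t} {E} {F} W V = record
  { edge  = λ u< v< u≢v → linear (edge W u< v< u≢v) (edge V u< v< u≢v)
  ; path  = λ u< v< w< p q r → ≤-trans (≤-reflexive (inter (E _ _) _ _ _))
              (linear (path W u< v< w< p q r) (path V u< v< w< p q r))
  ; left  = λ v< → quadratic (left W v<) (left V v<)
  ; right = λ v< → quadratic (right W v<) (right V v<)
  ; span  = ≤-trans (+-mono-≤ (span W) (span V))
              (≤-trans (≤-reflexive (sym (*-distribˡ-+ 2 (s * s) (t * t)))) (*-monoʳ-≤ 2 (quadratic ≤-refl ≤-refl)))
  }
  where
  inter : ∀ a b c d → a + b + (c + d) ≡ a + c + (b + d)
  inter = solve-∀
  linear : ∀ {a b} → a ≤ 2 * s → b ≤ 2 * t → a + b ≤ 2 * (s + t)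
  linear a≤ b≤ = ≤-trans (+-mono-≤ a≤ b≤) (≤-reflexive (sym (*-distribˡ-+ 2 s t)))
  square : ∀ s t → s * s + t * t + 2 * (s * t) ≡ (s + t) * (s + t)
  square = solve-∀
  quadratic : ∀ {a b} → a ≤ s * s → b ≤ t * t → a + b ≤ (s + t) * (s + t)
  quadratic a≤ b≤ = ≤-trans (+-mono-≤ a≤ b≤) (≤-trans (m≤m+n _ _) (≤-reflexive (square s t)))

-- A new edge avoiding `x` is bounded by an old edge or by the old path through `x`. A path through
-- three distinct variables meets `x`, so one of its edges is now `1`. A border distance gains at
-- most one edge, and s² + 2s ≤ (s + 1)².
Weight-eliminate : ∀ {s E x} → x < 3 → Weight s E → Weight (suc s) (eliminate x E)
Weight-eliminate {s} {E} {x} x< W = record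
  { edge  = edge′
  ; path  = path′
  ; left  = λ {v} v< → eliminate-≤ x E bot (var v) (s≤s z≤n) λ _ v≢ →
      ≤-trans (left W v<) (*-mono-≤ (n≤1+n s) (n≤1+n s)) ,
      ≤-trans (+-mono-≤ (left W x<) (edge W x< v< (λ x≡v → v≢ (cong var (sym x≡v))))) square
  ; right = λ {v} v< → eliminate-≤ x E (var v) top (s≤s z≤n) λ v≢ _ →
      ≤-trans (right W v<) (*-mono-≤ (n≤1+n s) (n≤1+n s)) ,
      ≤-trans (+-mono-≤ (edge W v< x< (v≢ ∘ cong var)) (right W x<))
        (≤-trans (≤-reflexive (+-comm (2 * s) (s * s))) square)
  ; span  = eliminate-≤ x E bot top (s≤s z≤n) λ _ _ →
      ≤-trans (span W) (*-monoʳ-≤ 2 (*-mono-≤ (n≤1+n s) (n≤1+n s))) ,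
      ≤-trans (+-mono-≤ (left W x<) (right W x<))
        (≤-trans (≤-reflexive (cong (s * s +_) (sym (+-identityʳ _)))) (*-monoʳ-≤ 2 (*-mono-≤ (n≤1+n s) (n≤1+n s))))
  }
  where
  square-suc : ∀ s → s * s + 2 * s + 1 ≡ suc s * suc s
  square-suc = solve-∀
  square : s * s + 2 * s ≤ suc s * suc s
  square = ≤-trans (m≤m+n _ 1) (≤-reflexive (square-suc s))
  grow : suc (1 ⊔ 2 * s) ≤ 2 * suc s
  grow = ≤-trans (s≤s (⊔-lub (s≤s z≤n) (n≤1+n (2 * s)))) (≤-reflexive (sym (*-suc 2 s)))
  -- The maximum with `1` accounts for the reset edges at `x`, also when `s` is `0`.
  edge-≤ : ∀ {u v} → u < 3 → v < 3 → u ≢ v → eliminate x E (var u) (var v) ≤ 1 ⊔ 2 * s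
  edge-≤ {u} {v} u< v< u≢v = eliminate-≤ x E (var u) (var v) (m≤m⊔n 1 (2 * s)) λ u≢ v≢ →
    ≤-trans (edge W u< v< u≢v) (m≤n⊔m 1 (2 * s)) ,
    ≤-trans (path W u< x< v< (u≢ ∘ cong var) (λ x≡v → v≢ (cong var (sym x≡v))) u≢v) (m≤n⊔m 1 (2 * s))
  edge′ : ∀ {u v} → u < 3 → v < 3 → u ≢ v → eliminate x E (var u) (var v) ≤ 2 * suc s
  edge′ u< v< u≢v = ≤-trans (edge-≤ u< v< u≢v) (≤-trans (n≤1+n _) grow)
  path′ : ∀ {u v w} → u < 3 → v < 3 → w < 3 → u ≢ v → v ≢ w → u ≢ w →
    eliminate x E (var u) (var v) + eliminate x E (var v) (var w) ≤ 2 * suc s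
  path′ {u} {v} {w} u< v< w< u≢v v≢w u≢w with pigeonhole₃ x< u< v< w< u≢v v≢w u≢w
  ... | inj₁ refl = ≤-trans
    (+-mono-≤ (≤-reflexive (eliminate-≡ˡ x E (var v))) (edge-≤ v< w< v≢w)) grow
  ... | inj₂ (inj₁ refl) = ≤-trans
    (+-mono-≤ (≤-reflexive (eliminate-≡ʳ x E (var u))) (edge-≤ v< w< v≢w)) grow
  ... | inj₂ (inj₂ refl) = ≤-trans
    (+-mono-≤ (edge-≤ u< v< u≢v) (≤-reflexive (eliminate-≡ʳ x E (var v))))
    (≤-trans (≤-reflexive (+-comm _ 1)) grow)

sep-Weight : ∀ φ → InFO 3 φ → Weight (size φ) (sep φ)
sep-Weight (x ≺ y)  _ = Weight-atom
sep-Weight (x ≐ y)  _ = Weight-atom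
sep-Weight (¬' φ)   h = Weight-mono (n≤1+n _) (sep-Weight φ h)
sep-Weight (φ ∧' ψ) (h , k) = Weight-mono (n≤1+n _) (Weight-+ (sep-Weight φ h) (sep-Weight ψ k))
sep-Weight (φ ∨' ψ) (h , k) = Weight-mono (n≤1+n _) (Weight-+ (sep-Weight φ h) (sep-Weight ψ k))
sep-Weight (∃' x φ) (x< , h) = Weight-eliminate x< (sep-Weight φ h)
sep-Weight (∀' x φ) (x< , h) = Weight-eliminate x< (sep-Weight φ h)

-- Short FO⁴-sentences for long orders

-- near m says ∣ x₀ − x₁ ∣ ≤ 2 ^ m.  Quantifying over both endpoints by the single variable x₃
-- keeps one recursive occurrence, hence linear size.
near : ℕ → Formula
near zero    = ¬' ∃' 2 (((0 ≺ 2) ∧' (2 ≺ 1)) ∨' ((1 ≺ 2) ∧' (2 ≺ 0)))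
near (suc m) = ∃' 2 (∀' 3 ((¬' ((3 ≐ 0) ∨' (3 ≐ 1))) ∨' ∃' 0 ((0 ≐ 2) ∧' ∃' 1 ((1 ≐ 3) ∧' near m))))

between : ∀ {N} (x y : Fin (suc N)) → ∃ (λ (z : Fin (suc N)) → x Fin.< z × z Fin.< y) ⊎ toℕ y ≤ suc (toℕ x)
between {N} x y with toℕ y ≤? suc (toℕ x)
... | yes le = inj₂ le
... | no ≰   = inj₁ (fromℕ< z< , subst (toℕ x <_) (sym z≡) (n<1+n _) , subst (_< toℕ y) (sym z≡) (≰⇒> ≰))
  where
  z< : suc (toℕ x) < suc N
  z< = <-trans (≰⇒> ≰) (toℕ<n y)
  z≡ : toℕ (fromℕ< z<) ≡ suc (toℕ x)
  z≡ = toℕ-fromℕ< z<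

∣-∣≤ : ∀ m n {k} → m ≤ n + k → n ≤ m + k → ∣ m - n ∣ ≤ k
∣-∣≤ m n {k} m≤ n≤ with ≤-total m n
... | inj₁ m≤n = subst (_≤ k) (sym (m≤n⇒∣m-n∣≡n∸m m≤n)) (m≤n+o⇒m∸n≤o n m n≤)
... | inj₂ n≤m = subst (_≤ k) (sym (m≤n⇒∣n-m∣≡n∸m n≤m)) (m≤n+o⇒m∸n≤o m n m≤)

≤+∣-∣ : ∀ m n {k} → ∣ m - n ∣ ≤ k → m ≤ n + k
≤+∣-∣ m n h = ≤-trans (m≤n+∣m-n∣ m n) (+-monoʳ-≤ n h)

midpoint-≤ : ∀ {N} (x y : Fin (suc N)) k → toℕ x ≤ toℕ y → ∣ toℕ x - toℕ y ∣ ≤ 2 * k →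
  ∃ λ (z : Fin (suc N)) → ∣ toℕ z - toℕ x ∣ ≤ k × ∣ toℕ z - toℕ y ∣ ≤ k
midpoint-≤ {N} x y k x≤y h = fromℕ< z< ,
  subst (λ n → ∣ n - toℕ x ∣ ≤ k) (sym (toℕ-fromℕ< z<))
    (∣-∣≤ z (toℕ x) (m⊓n≤m _ _) (≤-trans (⊓-glb (m≤m+n _ k) x≤y) (m≤m+n z k))) ,
  subst (λ n → ∣ n - toℕ y ∣ ≤ k) (sym (toℕ-fromℕ< z<))
    (∣-∣≤ z (toℕ y) (≤-trans (m⊓n≤n _ _) (m≤m+n _ k)) y≤z+k)
  where
  z : ℕ
  -- Capping at `y` keeps the point inside the order when `y` is closer than `k`.
  z = (toℕ x + k) ⊓ toℕ y
  z< : z < suc N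
  z< = ≤-<-trans (m⊓n≤n (toℕ x + k) (toℕ y)) (toℕ<n y)
  double : ∀ x k → x + 2 * k ≡ x + k + k
  double = solve-∀
  y≤z+k : toℕ y ≤ z + k
  y≤z+k = begin
    toℕ y                         ≤⟨ ⊓-glb (≤+∣-∣ (toℕ y) (toℕ x) (subst (_≤ 2 * k) (∣-∣-comm (toℕ x) _) h)) (m≤m+n _ k) ⟩
    (toℕ x + 2 * k) ⊓ (toℕ y + k) ≡⟨ cong (_⊓ (toℕ y + k)) (double (toℕ x) k) ⟩
    (toℕ x + k + k) ⊓ (toℕ y + k) ≡⟨ sym (+-distribʳ-⊓ k (toℕ x + k) (toℕ y)) ⟩
    z + k                         ∎

midpoint : ∀ {N} (x y : Fin (suc N)) k → ∣ toℕ x - toℕ y ∣ ≤ 2 * k →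
  ∃ λ (z : Fin (suc N)) → ∣ toℕ z - toℕ x ∣ ≤ k × ∣ toℕ z - toℕ y ∣ ≤ k
midpoint x y k h with ≤-total (toℕ x) (toℕ y)
... | inj₁ x≤y = midpoint-≤ x y k x≤y h
... | inj₂ y≤x = let z , h₀ , h₁ = midpoint-≤ y x k y≤x (subst (_≤ 2 * k) (∣-∣-comm (toℕ x) _) h) in z , h₁ , h₀

-- Taking each endpoint in turn for x₃ bounds its distance to `z` by 2^m; the triangle inequality
-- through `z` adds the two bounds.
near⇒ : ∀ m {N} a → Sat N a (near m) → ∣ toℕ (a 0) - toℕ (a 1) ∣ ≤ 2 ^ m
near⇒ zero a ¬s with between (a 0) (a 1) | between (a 1) (a 0)
... | inj₁ (z , lt , gt) | _ = contradiction (z , inj₁ (lt , gt)) ¬s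
... | inj₂ _ | inj₁ (z , lt , gt) = contradiction (z , inj₂ (lt , gt)) ¬s
... | inj₂ y≤ | inj₂ x≤ = ∣-∣≤ (toℕ (a 0)) _ (subst (toℕ (a 0) ≤_) (+-comm 1 _) x≤) (subst (toℕ (a 1) ≤_) (+-comm 1 _) y≤)
near⇒ (suc m) {N} a (z , h) = begin
  ∣ toℕ (a 0) - toℕ (a 1) ∣ ≤⟨ ∣-∣-triangle (toℕ (a 0)) (toℕ z) (toℕ (a 1)) ⟩
  ∣ toℕ (a 0) - toℕ z ∣ + ∣ toℕ z - toℕ (a 1) ∣
    ≤⟨ +-mono-≤ (≤-trans (≤-reflexive (∣-∣-comm (toℕ (a 0)) (toℕ z))) (endpoint (a 0) (inj₁ refl))) (endpoint (a 1) (inj₂ refl)) ⟩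
  2 ^ m + 2 ^ m ≡⟨ cong (2 ^ m +_) (sym (+-identityʳ _)) ⟩
  2 ^ suc m ∎
  where
  endpoint : ∀ d → d ≡ a 0 ⊎ d ≡ a 1 → ∣ toℕ z - toℕ d ∣ ≤ 2 ^ m
  endpoint d d∈ with h d
  ... | inj₁ ∉ = contradiction d∈ ∉
  ... | inj₂ (_ , refl , _ , refl , s) = near⇒ m _ s

⇒near : ∀ m {N} a → ∣ toℕ (a 0) - toℕ (a 1) ∣ ≤ 2 ^ m → Sat N a (near m)
⇒near zero a h (z , inj₁ (lt , gt)) = contradiction
  (≤-trans (s≤s lt) (≤-trans gt (subst (toℕ (a 1) ≤_) (+-comm _ 1) (≤+∣-∣ (toℕ (a 1)) (toℕ (a 0)) (subst (_≤ 1) (∣-∣-comm (toℕ (a 0)) _) h)))))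
  (<-irrefl refl)
⇒near zero a h (z , inj₂ (lt , gt)) = contradiction
  (≤-trans (s≤s lt) (≤-trans gt (subst (toℕ (a 0) ≤_) (+-comm _ 1) (≤+∣-∣ (toℕ (a 0)) (toℕ (a 1)) h))))
  (<-irrefl refl)
⇒near (suc m) {N} a h with midpoint (a 0) (a 1) (2 ^ m) h
... | z , h₀ , h₁ = z , body
  where
  body : ∀ d → (d ≡ a 0 ⊎ d ≡ a 1 → _) ⊎ _
  body d with d Fin.≟ a 0 | d Fin.≟ a 1
  ... | yes refl | _        = inj₂ (z , refl , d , refl , ⇒near m _ h₀)
  ... | no _     | yes refl = inj₂ (z , refl , d , refl , ⇒near m _ h₁)
  ... | no ≢₀    | no ≢₁    = inj₁ λ { (inj₁ eq) → ≢₀ eq ; (inj₂ eq) → ≢₁ eq }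

near-size : ∀ m → size (near m) ≡ 13 * m + 9
near-size zero    = refl
near-size (suc m) rewrite near-size m = eq m
  where
  eq : ∀ m → 13 + (13 * m + 9) ≡ 13 * suc m + 9
  eq = solve-∀

near-scoped : ∀ m {Γ} → 0 ∈ Γ → 1 ∈ Γ → Scoped Γ (near m)
near-scoped zero    0∈ 1∈ = ((there 0∈ , here refl) , (here refl , there 1∈)) , ((there 1∈ , here refl) , (here refl , there 0∈))
near-scoped (suc m) 0∈ 1∈ =
  ((here refl , there (there 0∈)) , (here refl , there (there 1∈))) ,
  (here refl , there (there (here refl))) , (here refl , there (there (here refl))) ,
  near-scoped m (there (here refl)) (here refl)

near-FO⁴ : ∀ m → InFO 4 (near m)
near-FO⁴ zero    = 2< , ((0< , 2<) , (2< , 1<)) , ((1< , 2<) , (2< , 0<))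
  where
  0< = s≤s {n = 3} z≤n
  1< = s≤s (s≤s {n = 2} z≤n)
  2< = s≤s (s≤s (s≤s {n = 1} z≤n))
near-FO⁴ (suc m) = 2< , 3< , ((3< , 0<) , (3< , 1<)) , 0< , (0< , 2<) , 1< , (1< , 3<) , near-FO⁴ m
  where
  0< = s≤s {n = 3} z≤n
  1< = s≤s (s≤s {n = 2} z≤n)
  2< = s≤s (s≤s (s≤s {n = 1} z≤n))
  3< = s≤s (s≤s (s≤s (s≤s {n = 0} z≤n)))

shortOrder : ℕ → Formula
shortOrder m = ∀' 0 (∀' 1 (near m))

shortOrder-size : ∀ m → size (shortOrder m) ≡ 13 * m + 11
shortOrder-size m rewrite near-size m = eq m
  where
  eq : ∀ m → 2 + (13 * m + 9) ≡ 13 * m + 11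
  eq = solve-∀

shortOrder-scoped : ∀ m → Sentence (shortOrder m)
shortOrder-scoped m = near-scoped m (there (here refl)) (here refl)

shortOrder-FO⁴ : ∀ m → InFO 4 (shortOrder m)
shortOrder-FO⁴ m = s≤s z≤n , s≤s (s≤s z≤n) , near-FO⁴ m

shortOrder-2^ : ∀ m → Models (2 ^ m) (shortOrder m)
shortOrder-2^ m d e = ⇒near m _ (∣-∣≤ (toℕ d) (toℕ e) (bound d (toℕ e)) (bound e (toℕ d)))
  where
  bound : ∀ (d : Fin (suc (2 ^ m))) n → toℕ d ≤ n + 2 ^ m
  bound d n = ≤-trans (≤-pred (toℕ<n d)) (m≤n+m (2 ^ m) n)

¬shortOrder-1+2^ : ∀ m → ¬ Models (suc (2 ^ m)) (shortOrder m)
¬shortOrder-1+2^ m h = contradiction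
  (subst (_≤ 2 ^ m) (toℕ-fromℕ (suc (2 ^ m))) (near⇒ m _ (h Fin.zero (fromℕ (suc (2 ^ m))))))
  (<-irrefl refl)

-- Otherwise the threshold of `ψ` between the two ends is at most 2^m, so `ψ` agrees on the orders
-- with N = 2^m and N = 2^m + 1, which `shortOrder m` separates.
FO³-lowerBound : ∀ m ψ → InFO 3 ψ → Sentence ψ → EquivOnOrders ψ (shortOrder m) →
  2 ^ m < 2 * (size ψ ^ 2)
FO³-lowerBound m ψ fo sc eqv = ≰⇒> λ small →
  let sep≤ = ≤-trans (span (sep-Weight ψ fo))
        (subst (λ n → 2 * (size ψ * n) ≤ 2 ^ m) (*-identityʳ (size ψ)) small) in
  ¬shortOrder-1+2^ m (to (eqv (suc (2 ^ m)))
    (Models-transfer ψ sc sep≤ (≤-trans sep≤ (n≤1+n _)) (from (eqv (2 ^ m)) (shortOrder-2^ m))))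
  where open Equivalence

-- Subexponential functions and the conclusion

^-distrib-* : ∀ m n k → (m * n) ^ k ≡ m ^ k * n ^ k
^-distrib-* m n zero    = refl
^-distrib-* m n (suc k) = trans (cong (m * n *_) (^-distrib-* m n k)) (inter m n (m ^ k) (n ^ k))
  where
  inter : ∀ a b c d → a * b * (c * d) ≡ a * c * (b * d)
  inter = solve-∀

-- If 2^m < 2F², raising to the power k = a + 2 gives 2^(mk) < 2^k F^(2k). Subexponentiality with q
-- = 2k bounds F^(2k) by 2^((a+1)m+b), whose exponent has a slope below k, a contradiction for large
-- m.
subexponential-square : ∀ f → SubExponential f → ∀ a b →
  ∃ λ m → 2 * (f (suc a * m + b) ^ 2) ≤ 2 ^ m
subexponential-square f sub a b with sub (2 * (2 + a)) (s≤s z≤n)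
... | m₀ , bound = m , ≮⇒≥ λ lt → contradiction
    (begin-strict
      2 ^ (m * k)                 ≡⟨ sym (^-*-assoc 2 m k) ⟩
      (2 ^ m) ^ k                 <⟨ ^-monoˡ-< k lt ⟩
      (2 * F ^ 2) ^ k             ≡⟨ ^-distrib-* 2 (F ^ 2) k ⟩
      2 ^ k * (F ^ 2) ^ k         ≡⟨ cong (2 ^ k *_) (^-*-assoc F 2 k) ⟩
      2 ^ k * F ^ (2 * k)         ≤⟨ *-monoʳ-≤ (2 ^ k) (bound (suc a * m + b) m₀≤) ⟩
      2 ^ k * 2 ^ (suc a * m + b) ≡⟨ sym (^-distribˡ-+-* 2 k (suc a * m + b)) ⟩
      2 ^ (k + (suc a * m + b))   ≤⟨ ^-monoʳ-≤ 2 exponents ⟩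
      2 ^ (m * k)                 ∎)
    (<-irrefl refl)
  where
  k m F : ℕ
  k = 2 + a
  -- The summand `m₀` puts the argument of `f` in the range of `bound`; `k + b` is covered by the
  -- surplus m of m * k over (a + 1) * m.
  m = m₀ + (k + b)
  F = f (suc a * m + b)
  m₀≤ : m₀ ≤ suc a * m + b
  m₀≤ = ≤-trans (m≤m+n m₀ (k + b)) (≤-trans (m≤m+n m (a * m)) (m≤m+n _ b))
  split : ∀ a b m₀ → 2 + a + (suc a * (m₀ + (2 + a + b)) + b) + m₀ ≡ (m₀ + (2 + a + b)) * (2 + a)
  split = solve-∀
  exponents : k + (suc a * m + b) ≤ m * k
  exponents = ≤-trans (m≤m+n _ m₀) (≤-reflexive (split a b m₀))

theorem5p3 : (∃ λ (c : ℕ) → (φ : Formula) → Sentence φ →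
    Σ Formula λ ψ → InFO 3 ψ × Sentence ψ × size ψ ≤ 2 ^ (c * size φ) × EquivOnOrders ψ φ)
    ×
    ¬ (Σ (ℕ → ℕ) λ f → SubExponential f ×
    ((φ : Formula) → InFO 4 φ → Sentence φ →
    Σ Formula λ ψ → InFO 3 ψ × Sentence ψ × size ψ ≤ f (size φ) × EquivOnOrders ψ φ))
theorem5p3 = (8 , FO³-upperBound) , λ (f , sub , translate) →
  -- These arguments encode the size 13 * m + 11 of `shortOrder m`, the slope being the successor of
  -- `12`.
  let m , small = subexponential-square f sub 12 11
      ψ , fo , sc , size≤ , eqv = translate (shortOrder m) (shortOrder-FO⁴ m) (shortOrder-scoped m)
      size≤′ = subst (λ n → size ψ ≤ f n) (shortOrder-size m) size≤
  in <-irrefl refl (<-≤-trans (FO³-lowerBound m ψ fo sc eqv)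
       (≤-trans (*-monoʳ-≤ 2 (^-monoˡ-≤ 2 size≤′)) small))
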